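{- Let $\mathcal G=(V_{\min},V_{\max},E,w,\lambda)$ be an improving discounted payoff game, $\sigma$ a joint strategy, and $\nu$ a valuation that is the valuation of some basis $\mathbf b$ of $H$, satisfies all inequations of $H$, and minimises $f_\sigma$ among all valuations satisfying $H$, with $f_\sigma(\nu)\neq0$. Suppose there are no local improvements of $\sigma$ for $\nu$, i.e. $\mathsf{offset}(\nu,(v,v'))\ge\mathsf{offset}(\nu,(v,\sigma(v)))$ for all $(v,v')\in E$. Then there is (at least) one neighbouring valuation $\nu''$ of $\nu$ such that there is a joint strategy $\sigma'$ with $f_{\sigma'}(\nu'')<f_\sigma(\nu)$. Such a strategy $\sigma'$ is better than $\sigma$, and, for a given set $E'$ of edges with $E_\nu\subseteq E'\subseteq S^\sigma_\nu$ containing an outgoing edge of every vertex, it can be selected so that $(v,\sigma'(v))\in E'$ for all $v\in V$.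
   Context: A DPG is a tuple $\mathcal G=(V_{\min},V_{\max},E,w,\lambda)$ with $V=V_{\min}\cup V_{\max}$ a finite vertex set partitioned into disjoint sets, $E\subseteq V\times V$ with every vertex having an outgoing edge, $w:E\to\mathbb R$, $\lambda:E\to[0,1)$. A joint strategy is a map $\sigma:V\to V$ with $(v,\sigma(v))\in E$ for all $v$. For an edge $e=(v,v')$ the inequation $I_e$ on a valuation $\nu:V\to\mathbb R$ is $\nu(v)\ge w_e+\lambda_e\nu(v')$ if $v\in V_{\max}$ and $\nu(v)\le w_e+\lambda_e\nu(v')$ otherwise; $H=\{I_e\mid e\in E\}$; $I_e$ is sharp for $\nu$ if it holds with equality. $\mathsf{offset}(\nu,(v,v'))=\nu(v)-(w_{(v,v')}+\lambda_{(v,v')}\nu(v'))$ if $v\in V_{\max}$ and $(w_{(v,v')}+\lambda_{(v,v')}\nu(v'))-\nu(v)$ otherwise; $f_\sigma(\nu)=\sum_{v\in V}\mathsf{offset}(\nu,(v,\sigma(v)))$. A basis of $H$ is a set of $|V|$ inequations of $H$ which, taken as equations, have a unique solution $\mathrm{val}(\mathbf b)$. A neighbouring valuation of $\nu=\mathrm{val}(\mathbf b)$ is a valuation $\mathrm{val}(\mathbf b')$ of a basis $\mathbf b'$ obtained from $\mathbf b$ by replacing exactly one inequation. The game is sharp if every valuation that is the valuation of a basis and satisfies $H$ makes exactly $|V|$ inequations of $H$ sharp. A sharp game is improving if for every joint strategy $\sigma$ and every basis $\mathbf b$ whose valuation satisfies $H$ but does not minimise $f_\sigma$ over the valuations satisfying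 $H$, there is a basis $\mathbf b'$ differing from $\mathbf b$ in exactly one inequation whose valuation satisfies $H$ and has strictly smaller $f_\sigma$-value. $S^\sigma_\nu=\{(v,v')\in E\mid \mathsf{offset}(\nu,(v,v'))=\mathsf{offset}(\nu,(v,\sigma(v)))\}$ and $E_\nu=\{e\in E\mid\mathsf{offset}(\nu,e)=0\}$. A joint strategy $\sigma'$ is better than $\sigma$ if $\min\{f_{\sigma'}(\mu)\mid \mu\text{ satisfies }H\}<\min\{f_\sigma(\mu)\mid\mu\text{ satisfies }H\}$. -}

module Defs where

open import Data.Nat using (ℕ; zero; suc)
open import Data.Fin using (Fin; zero; suc)
open import Data.Bool using (Bool; true; false; T; if_then_else_)
open import Data.Product using (Σ; ∃; ∃-syntax; _×_; _,_)
open import Relation.Binary.PropositionalEquality using (_≡_; _≢_)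
open import Relation.Binary.Structures using (IsTotalOrder)
open import Relation.Binary.Core using (Rel)
open import Algebra.Core using (Op₁; Op₂)
open import Algebra.Structures using (IsCommutativeRing)
open import Relation.Nullary using (¬_)

-- The real numbers, axiomatised as a Dedekind-complete ordered field.
-- (Every model is isomorphic to ℝ, so quantifying over all models is
-- the same as speaking about ℝ.)

record RealField : Set₁ where
  infixl 6 _+_
  infixl 7 _*_
  infix  4 _≤_
  field
    Carrier : Set
    _+_ _*_ : Op₂ Carrier
    -_      : Op₁ Carrier
    0# 1#   : Carrier
    _≤_     : Rel Carrier _
    isCommutativeRing : IsCommutativeRing _≡_ _+_ _*_ -_ 0# 1#
    0≢1     : 0# ≢ 1#
    inverse : ∀ x → x ≢ 0# → ∃[ y ] (x * y ≡ 1#)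
    isTotalOrder : IsTotalOrder _≡_ _≤_
    +-mono-≤ : ∀ x y z → x ≤ y → x + z ≤ y + z
    *-nonneg : ∀ x y → 0# ≤ x → 0# ≤ y → 0# ≤ x * y
    sup : (P : Carrier → Set) → ∃ P → (∃[ b ] (∀ x → P x → x ≤ b)) →
          ∃[ s ] ((∀ x → P x → x ≤ s) × (∀ b → (∀ x → P x → x ≤ b) → s ≤ b))

  infixl 6 _-_
  _-_ : Op₂ Carrier
  x - y = x + (- y)

  infix 4 _<_
  _<_ : Rel Carrier _
  x < y = x ≤ y × x ≢ y

module Game (R : RealField) where
  open RealField R

  sumFin : ∀ {n} → (Fin n → Carrier) → Carrier
  sumFin {zero}  f = 0#
  sumFin {suc n} f = f zero + sumFin (λ i → f (suc i))

  record DPG (n : ℕ) : Set where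
    field
      isMax : Fin n → Bool
      edge  : Fin n → Fin n → Bool
      w     : Fin n → Fin n → Carrier
      disc  : Fin n → Fin n → Carrier
      disc-range : ∀ u v → T (edge u v) → (0# ≤ disc u v) × (disc u v < 1#)
      out   : ∀ u → ∃[ v ] T (edge u v)

  Valuation : ℕ → Set
  Valuation n = Fin n → Carrier

  Edge : ℕ → Set
  Edge n = Fin n × Fin n

  module _ {n : ℕ} (G : DPG n) where
    open DPG G

    InE : Edge n → Set
    InE (u , v) = T (edge u v)

    Holds : Valuation n → Edge n → Set
    Holds ν (u , v) = if isMax u then (w u v + disc u v * ν v ≤ ν u)
                                 else (ν u ≤ w u v + disc u v * ν v)

    Sharp : Valuation n → Edge n → Set
    Sharp ν (u , v) = ν u ≡ w u v + disc u v * ν v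

    SatH : Valuation n → Set
    SatH ν = ∀ e → InE e → Holds ν e

    offset : Valuation n → Edge n → Carrier
    offset ν (u , v) = if isMax u then ν u - (w u v + disc u v * ν v)
                                  else (w u v + disc u v * ν v) - ν u

    JointStrategy : (Fin n → Fin n) → Set
    JointStrategy σ = ∀ v → InE (v , σ v)

    f : (Fin n → Fin n) → Valuation n → Carrier
    f σ ν = sumFin (λ v → offset ν (v , σ v))

    -- A family of |V| = n inequations of H, indexed by Fin n.
    Family : Set
    Family = Fin n → Edge n

    Solves : Family → Valuation n → Set
    Solves b ν = ∀ i → Sharp ν (b i)

    IsBasis : Family → Set
    IsBasis b = (∀ i j → b i ≡ b j → i ≡ j) × (∀ i → InE (b i)) ×
                (∃[ ν ] Solves b ν) ×
                (∀ ν μ → Solves b ν → Solves b μ → ∀ v → ν v ≡ μ v)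

    IsValOf : Family → Valuation n → Set
    IsValOf b ν = IsBasis b × Solves b ν

    Neighbour : Family → Family → Set
    Neighbour b b' = Σ (Fin n) λ i → (∀ j → j ≢ i → b' j ≡ b j) ×
                                     (∀ j → b' i ≢ b j)

    -- the game is sharp: every valuation of a basis that satisfies H makes
    -- exactly n inequations of H sharp (the set of sharp inequations is in
    -- bijection with Fin n)
    IsSharpGame : Set
    IsSharpGame = ∀ b ν → IsValOf b ν → SatH ν →
      Σ (Fin n → Edge n) λ s → (∀ i j → s i ≡ s j → i ≡ j) ×
        (∀ e → (InE e × Sharp ν e) → ∃[ i ] (s i ≡ e)) ×
        (∀ i → InE (s i) × Sharp ν (s i))

    Minimises : (Fin n → Fin n) → Valuation n → Set
    Minimises σ ν = ∀ μ → SatH μ → f σ ν ≤ f σ μ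

    IsImproving : Set
    IsImproving = IsSharpGame ×
      (∀ σ → JointStrategy σ → ∀ b ν → IsValOf b ν → SatH ν →
         ¬ Minimises σ ν →
         Σ Family λ b' → Σ (Valuation n) λ ν' →
           Neighbour b b' × IsValOf b' ν' × SatH ν' × (f σ ν' < f σ ν))

    IsMinValue : (Fin n → Fin n) → Carrier → Set
    IsMinValue σ m = (∃[ μ ] (SatH μ × f σ μ ≡ m)) ×
                     (∀ μ → SatH μ → m ≤ f σ μ)

    Better : (Fin n → Fin n) → (Fin n → Fin n) → Set
    Better σ' σ = ∃[ m' ] ∃[ m ] (IsMinValue σ' m' × IsMinValue σ m × m' < m)

    S : (Fin n → Fin n) → Valuation n → Edge n → Set
    S σ ν (u , v) = InE (u , v) × (offset ν (u , v) ≡ offset ν (u , σ u))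

    Eν : Valuation n → Edge n → Set
    Eν ν e = InE e × (offset ν e ≡ 0#)

{-# OPTIONS --safe #-}

-- Restrict the game to one E'-edge ψ u per vertex together with all edges that
-- are sharp for ν. Let s be the value of this game and σ' choose edges that are
-- sharp for s, so that f_σ'(s) = 0. The segment from ν to s stays feasible for
-- a while: edges sharp for ν are satisfied by s, the others have slack. Along
-- it f_σ' decreases from f_σ'(ν) = f_σ(ν) > 0, so ν is not minimal for σ', and
-- an improving game then provides the neighbour ν''. The minimum of f_σ' is
-- attained because further improvement steps must stop.
--
-- Constructively, completeness of the reals for arbitrary predicates gives weak
-- excluded middle, and with it decidable equality and order on the reals.

module Submission where

open import Defs
open import Data.Nat using (ℕ)
open import Data.Fin using (Fin)
open import Data.Product using (Σ; ∃; ∃-syntax; _×_; _,_)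
open import Relation.Binary.PropositionalEquality using (_≡_; _≢_)
open import Algebra.Bundles using (CommutativeMonoid; CommutativeRing)
import Algebra.Properties.AbelianGroup as AbelianGroupProperties
import Algebra.Properties.CommutativeSemigroup as CommutativeSemigroupProperties
import Algebra.Properties.Ring as RingProperties
import Algebra.Properties.Semiring.Mult.TCOptimised as Mult
import Algebra.Solver.Ring as RingSolver
open import Algebra.Solver.Ring.AlmostCommutativeRing using (fromCommutativeRing; _-Raw-AlmostCommutative⟶_)
open import Data.Bool using (Bool; true; false)
open import Data.Bool.Properties using (T?)
open import Data.Empty using (⊥-elim)
open import Data.Fin using (combine; finToFun; funToFin; zero; suc)
open import Data.Fin.Induction using (spo-wellFounded)
open import Data.Fin.Properties using (combine-injective; finToFun-funToFin)
open import Data.Integer as ℤ using (ℤ; +_; -[1+_])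
import Data.Integer.Properties as ℤ
open import Data.List using (List; _∷_; allFin; filter; map)
import Data.List.Extrema as Extrema
open import Data.List.Membership.Propositional using (_∈_)
open import Data.List.Membership.Propositional.Properties using (∈-allFin; ∈-filter⁺; ∈-filter⁻; ∈-map⁺)
open import Data.List.Relation.Unary.All as All using ()
open import Data.List.Relation.Unary.Any using (here; there)
open import Data.Maybe as Maybe using ()
import Data.Nat as ℕ
import Data.Nat.Properties as ℕ
open import Data.Product using (proj₁; proj₂; uncurry)
open import Data.Sign as Sign using ()
open import Data.Sum using (_⊎_; inj₁; inj₂)
open import Function using (_∘_)
open import Induction.WellFounded using (Acc; acc; WellFounded)
open import Level using (0ℓ)
open import Relation.Binary.Bundles using (TotalOrder)
open import Relation.Binary.Consequences using (dec⇒weaklyDec)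
import Relation.Binary.Construct.Flip.EqAndOrd as Flip
open import Relation.Binary.PropositionalEquality using (refl; sym; trans; cong; cong₂; subst; subst₂; isEquivalence)
open import Relation.Binary.Structures using (IsTotalOrder)
open import Relation.Nullary using (¬_; Dec; yes; no)
open import Relation.Nullary.Decidable using (_×-dec_; decidable-stable)

-- A ring solver with integer coefficients.

module IntegerSolver (R : CommutativeRing 0ℓ 0ℓ) where
  open CommutativeRing R renaming (refl to ≈-refl; sym to ≈-sym; trans to ≈-trans)
  open RingProperties ring using (-‿distribˡ-*; -‿distribʳ-*; -0#≈0#)
  open AbelianGroupProperties +-abelianGroup using (⁻¹-involutive; ⁻¹-∙-comm; xyx⁻¹≈y)
  open Mult semiring using () renaming (_×_ to _·_; ×-homo-+ to ·-homo-+; ×1-homo-* to ·1-homo-*; 1+× to 1+·)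
  open import Relation.Binary.Reasoning.Setoid setoid

  fromℤ : ℤ → Carrier
  fromℤ (+ n)    = n · 1#
  fromℤ -[1+ n ] = - (ℕ.suc n · 1#)

  fromℤ-neg : ∀ i → fromℤ (ℤ.- i) ≈ - fromℤ i
  fromℤ-neg (+ ℕ.zero)  = ≈-sym -0#≈0#
  fromℤ-neg (+ ℕ.suc n) = ≈-refl
  fromℤ-neg -[1+ n ]    = ≈-sym (⁻¹-involutive _)

  fromℤ-⊖ : ∀ m n → fromℤ (m ℤ.⊖ n) ≈ m · 1# - n · 1#
  fromℤ-⊖ m       ℕ.zero    = ≈-sym (≈-trans (+-congˡ -0#≈0#) (+-identityʳ _))
  fromℤ-⊖ ℕ.zero    (ℕ.suc n) = ≈-sym (+-identityˡ _)
  fromℤ-⊖ (ℕ.suc m) (ℕ.suc n) = begin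
    fromℤ (ℕ.suc m ℤ.⊖ ℕ.suc n)                ≡⟨ cong fromℤ (ℤ.[1+m]⊖[1+n]≡m⊖n m n) ⟩
    fromℤ (m ℤ.⊖ n)                        ≈⟨ fromℤ-⊖ m n ⟩
    m · 1# - n · 1#                        ≈⟨ +-congʳ (xyx⁻¹≈y 1# _) ⟨
    (1# + m · 1# - 1#) - n · 1#            ≈⟨ +-assoc _ _ _ ⟩
    (1# + m · 1#) + (- 1# - n · 1#)        ≈⟨ +-congˡ (⁻¹-∙-comm _ _) ⟩
    (1# + m · 1#) - (1# + n · 1#)          ≈⟨ +-cong (1+· m 1#) (-‿cong (1+· n 1#)) ⟨
    ℕ.suc m · 1# - ℕ.suc n · 1#                ∎

  fromℤ-+ : ∀ i j → fromℤ (i ℤ.+ j) ≈ fromℤ i + fromℤ j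
  fromℤ-+ (+ m)    (+ n)    = ·-homo-+ 1# m n
  fromℤ-+ (+ m)    -[1+ n ] = fromℤ-⊖ m (ℕ.suc n)
  fromℤ-+ -[1+ m ] (+ n)    = ≈-trans (fromℤ-⊖ n (ℕ.suc m)) (+-comm _ _)
  fromℤ-+ -[1+ m ] -[1+ n ] = begin
    - (ℕ.suc (ℕ.suc (m ℕ.+ n)) · 1#)     ≡⟨ cong (λ k → - (ℕ.suc k · 1#)) (ℕ.+-suc m n) ⟨
    - ((ℕ.suc m ℕ.+ ℕ.suc n) · 1#)       ≈⟨ -‿cong (·-homo-+ 1# (ℕ.suc m) (ℕ.suc n)) ⟩
    - (ℕ.suc m · 1# + ℕ.suc n · 1#)      ≈⟨ ⁻¹-∙-comm _ _ ⟨
    - (ℕ.suc m · 1#) - (ℕ.suc n · 1#)    ∎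

  fromℤ-pos◃ : ∀ n → fromℤ (Sign.+ ℤ.◃ n) ≈ n · 1#
  fromℤ-pos◃ ℕ.zero    = ≈-refl
  fromℤ-pos◃ (ℕ.suc n) = ≈-refl

  fromℤ-neg◃ : ∀ n → fromℤ (Sign.- ℤ.◃ n) ≈ - (n · 1#)
  fromℤ-neg◃ ℕ.zero    = ≈-sym -0#≈0#
  fromℤ-neg◃ (ℕ.suc n) = ≈-refl

  fromℤ-* : ∀ i j → fromℤ (i ℤ.* j) ≈ fromℤ i * fromℤ j
  fromℤ-* (+ m)    (+ n)    = ≈-trans (fromℤ-pos◃ (m ℕ.* n)) (·1-homo-* m n)
  fromℤ-* (+ m)    -[1+ n ] = begin
    fromℤ (Sign.- ℤ.◃ m ℕ.* ℕ.suc n)   ≈⟨ fromℤ-neg◃ (m ℕ.* ℕ.suc n) ⟩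
    - ((m ℕ.* ℕ.suc n) · 1#)           ≈⟨ -‿cong (·1-homo-* m (ℕ.suc n)) ⟩
    - (m · 1# * ℕ.suc n · 1#)          ≈⟨ -‿distribʳ-* _ _ ⟩
    m · 1# * - (ℕ.suc n · 1#)          ∎
  fromℤ-* -[1+ m ] (+ n)    = begin
    fromℤ (Sign.- ℤ.◃ ℕ.suc m ℕ.* n)   ≈⟨ fromℤ-neg◃ (ℕ.suc m ℕ.* n) ⟩
    - ((ℕ.suc m ℕ.* n) · 1#)           ≈⟨ -‿cong (·1-homo-* (ℕ.suc m) n) ⟩
    - (ℕ.suc m · 1# * n · 1#)          ≈⟨ -‿distribˡ-* _ _ ⟩
    - (ℕ.suc m · 1#) * n · 1#          ∎
  fromℤ-* -[1+ m ] -[1+ n ] = begin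
    (ℕ.suc m ℕ.* ℕ.suc n) · 1#               ≈⟨ ·1-homo-* (ℕ.suc m) (ℕ.suc n) ⟩
    ℕ.suc m · 1# * ℕ.suc n · 1#              ≈⟨ ⁻¹-involutive _ ⟨
    - - (ℕ.suc m · 1# * ℕ.suc n · 1#)        ≈⟨ -‿cong (-‿distribʳ-* _ _) ⟩
    - (ℕ.suc m · 1# * - (ℕ.suc n · 1#))      ≈⟨ -‿distribˡ-* _ _ ⟩
    - (ℕ.suc m · 1#) * - (ℕ.suc n · 1#)      ∎

  -- Integer coefficients have decidable equality, so the solver can cancel terms over a ring whose
  -- own equality is not known to be decidable.
  morphism : ℤ.+-*-rawRing -Raw-AlmostCommutative⟶ fromCommutativeRing R
  morphism = record
    { ⟦_⟧    = fromℤ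
    ; +-homo = fromℤ-+
    ; *-homo = fromℤ-*
    ; -‿homo = fromℤ-neg
    ; 0-homo = ≈-refl
    ; 1-homo = ≈-refl
    }

  open RingSolver ℤ.+-*-rawRing (fromCommutativeRing R) morphism
    (λ i j → Maybe.map (λ i≡j → reflexive (cong fromℤ i≡j)) (dec⇒weaklyDec ℤ._≟_ i j)) public

-- Ordered field arithmetic and consequences of completeness.

module OrderedField (R : RealField) where
  open RealField R
  open IsTotalOrder isTotalOrder public
    using (total; antisym)
    renaming (refl to ≤-refl; reflexive to ≤-reflexive; trans to ≤-trans)

  commutativeRing : CommutativeRing 0ℓ 0ℓ
  commutativeRing = record { isCommutativeRing = isCommutativeRing }

  open CommutativeRing commutativeRing using (*-comm)
  open IntegerSolver commutativeRing public
    using (Polynomial; solve; con; _:+_; _:-_; _:*_; :-_; _:=_)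

  ≤-totalOrder : TotalOrder 0ℓ 0ℓ 0ℓ
  ≤-totalOrder = record { isTotalOrder = isTotalOrder }

  :0 :1 : ∀ {k} → Polynomial k
  :0 = con (+ 0)
  :1 = con (+ 1)

  0≤y-x : ∀ {x y} → x ≤ y → 0# ≤ y - x
  0≤y-x {x} {y} x≤y =
    subst (_≤ y - x) (solve 1 (λ x → x :- x := :0) refl x) (+-mono-≤ x y (- x) x≤y)

  -- Splits an inequality into a polynomial identity for the difference, left to the solver, and the
  -- nonnegativity of its right-hand side.
  ≤-from : ∀ {x y d} → y - x ≡ d → 0# ≤ d → x ≤ y
  ≤-from {x} {y} refl 0≤d = subst₂ _≤_
    (solve 1 (λ x → :0 :+ x := x) refl x)
    (solve 2 (λ x y → y :- x :+ x := y) refl x y)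
    (+-mono-≤ 0# (y - x) x 0≤d)

  +-nonneg : ∀ {x y} → 0# ≤ x → 0# ≤ y → 0# ≤ x + y
  +-nonneg {x} {y} 0≤x 0≤y =
    ≤-trans 0≤x (≤-from (solve 2 (λ x y → x :+ y :- x := y) refl x y) 0≤y)

  0≤1 : 0# ≤ 1#
  0≤1 with total 0# 1#
  ... | inj₁ p = p
  -- If `1# ≤ 0#`, then `0# - 1#` is nonnegative, and so is its square, which is `1#`.
  ... | inj₂ p = subst (0# ≤_)
    (solve 0 ((:0 :- :1) :* (:0 :- :1) := :1) refl)
    (*-nonneg _ _ (0≤y-x p) (0≤y-x p))

  1≰0 : ¬ (1# ≤ 0#)
  1≰0 p = 0≢1 (antisym 0≤1 p)

  x-y≡0⇒x≡y : ∀ {x y} → x - y ≡ 0# → x ≡ y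
  x-y≡0⇒x≡y {x} {y} p = trans (solve 2 (λ x y → x := x :- y :+ y) refl x y)
    (trans (cong (_+ y) p) (solve 1 (λ y → :0 :+ y := y) refl y))

  -- The z with ¬ ¬ (z ≡ 0) form a subgroup; if s is its supremum and x a
  -- member, then s - x is also an upper bound, which forces x ≤ 0.
  ≡0-stable : ∀ {x} → ¬ ¬ (x ≡ 0#) → x ≡ 0#
  ≡0-stable {x} ¬¬x≡0 = antisym (nonpos ¬¬x≡0)
    (≤-from (solve 1 (λ x → x :- :0 := :0 :- :- x) refl x) (0≤y-x (nonpos (neg ¬¬x≡0))))
    where
    Infinitesimal : Carrier → Set
    Infinitesimal z = ¬ ¬ (z ≡ 0#)

    neg : ∀ {z} → Infinitesimal z → Infinitesimal (- z)
    neg p k = p λ { refl → k (solve 0 (:- :0 := :0) refl) }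

    add : ∀ {y z} → Infinitesimal y → Infinitesimal z → Infinitesimal (y + z)
    add p q k = p λ { refl → q λ { refl → k (solve 0 (:0 :+ :0 := :0) refl) } }

    ≤1 : ∀ z → Infinitesimal z → z ≤ 1#
    ≤1 z p with total z 1#
    ... | inj₁ z≤1 = z≤1
    ... | inj₂ 1≤z = ⊥-elim (p λ { refl → 1≰0 1≤z })

    nonpos : ∀ {x} → Infinitesimal x → x ≤ 0#
    nonpos {x} p with sup Infinitesimal (0# , λ k → k refl) (1# , ≤1)
    ... | s , upper , least =
      ≤-from (solve 2 (λ s x → :0 :- x := s :- x :- s) refl s x)
        (0≤y-x (least (s - x) λ z q →
          ≤-from (solve 3 (λ s x z → s :- x :- z := s :- (z :+ x)) refl s x z)
            (0≤y-x (upper (z + x) (add q p)))))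

  -- The supremum of {0} ∪ {1 ∣ A}, compared with 1/2, decides ¬ A.
  weak-excluded-middle : (A : Set) → ¬ A ⊎ ¬ ¬ A
  weak-excluded-middle A with sup P (0# , inj₁ refl) (1# , ≤1)
    where
    P : Carrier → Set
    P z = z ≡ 0# ⊎ (z ≡ 1# × A)

    ≤1 : ∀ z → P z → z ≤ 1#
    ≤1 z (inj₁ refl)       = 0≤1
    ≤1 z (inj₂ (refl , _)) = ≤-refl
  ... | s , upper , least with total (s + s) 1#
  ...   | inj₁ 2s≤1 = inj₁ λ a →
    let 0≤s-1 = 0≤y-x (upper 1# (inj₂ (refl , a))) in
    1≰0 (≤-from (solve 1 (λ s → :0 :- :1 := (s :- :1) :+ (s :- :1) :+ (:1 :- (s :+ s))) refl s)
      (+-nonneg (+-nonneg 0≤s-1 0≤s-1) (0≤y-x 2s≤1)))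
  ...   | inj₂ 1≤2s = inj₂ λ ¬a →
    let 0≤-s = 0≤y-x (least 0# λ { z (inj₁ refl) → ≤-refl ; z (inj₂ (_ , a)) → ⊥-elim (¬a a) }) in
    1≰0 (≤-from (solve 1 (λ s → :0 :- :1 := (:0 :- s) :+ (:0 :- s) :+ (s :+ s :- :1)) refl s)
      (+-nonneg (+-nonneg 0≤-s 0≤-s) (0≤y-x 1≤2s)))

  *-monoʳ-≤ : ∀ {k x y} → 0# ≤ k → x ≤ y → k * x ≤ k * y
  *-monoʳ-≤ {k} {x} {y} 0≤k x≤y = ≤-from
    (solve 3 (λ k x y → k :* y :- k :* x := k :* (y :- x)) refl k x y)
    (*-nonneg _ _ 0≤k (0≤y-x x≤y))

  *-monoˡ-≤ : ∀ {k x y} → 0# ≤ k → x ≤ y → x * k ≤ y * k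
  *-monoˡ-≤ {k} {x} {y} 0≤k x≤y = subst₂ _≤_ (*-comm k x) (*-comm k y) (*-monoʳ-≤ 0≤k x≤y)

  infix 4 _≟_ _≤?_

  -- Weak excluded middle leaves inequality or doubly negated equality; the latter passes to the
  -- difference `x - y`, where stability at `0#` removes the double negation.
  _≟_ : (x y : Carrier) → Dec (x ≡ y)
  x ≟ y with weak-excluded-middle (x ≡ y)
  ... | inj₁ x≢y   = no x≢y
  ... | inj₂ ¬¬x≡y = yes (x-y≡0⇒x≡y (≡0-stable λ k → ¬¬x≡y λ { refl →
    k (solve 1 (λ x → x :- x := :0) refl x) }))

  _≤?_ : (x y : Carrier) → Dec (x ≤ y)
  x ≤? y with total x y | x ≟ y
  ... | inj₁ x≤y | _        = yes x≤y
  ... | inj₂ _   | yes x≡y  = yes (≤-reflexive x≡y)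
  ... | inj₂ y≤x | no x≢y   = no λ x≤y → x≢y (antisym x≤y y≤x)

  <-trans : ∀ {x y z} → x < y → y < z → x < z
  <-trans (x≤y , x≢y) (y≤z , _) =
    ≤-trans x≤y y≤z , λ { refl → x≢y (antisym x≤y y≤z) }

  ≤-<-trans : ∀ {x y z} → x ≤ y → y < z → x < z
  ≤-<-trans x≤y (y≤z , y≢z) =
    ≤-trans x≤y y≤z , λ { refl → y≢z (antisym y≤z x≤y) }

  0<y-x : ∀ {x y} → x < y → 0# < y - x
  0<y-x (x≤y , x≢y) = 0≤y-x x≤y , λ 0≡y-x → x≢y (sym (x-y≡0⇒x≡y (sym 0≡y-x)))

  pos-inverse : ∀ {x} → 0# < x → ∃[ y ] (0# ≤ y × x * y ≡ 1#)
  pos-inverse {x} (0≤x , 0≢x) with inverse x (0≢x ∘ sym)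
  ... | y , xy≡1 with total 0# y
  ...   | inj₁ 0≤y = y , 0≤y , xy≡1
  -- A nonpositive inverse would make `0# - 1#`, which equals `x * (0# - y)`, nonnegative.
  ...   | inj₂ y≤0 = ⊥-elim (1≰0 (≤-from
    (trans (cong (λ z → 0# - z) (sym xy≡1)) (solve 2 (λ x y → :0 :- x :* y := x :* (:0 :- y)) refl x y))
    (*-nonneg _ _ 0≤x (0≤y-x y≤0))))

  1*-cancel : ∀ {d y} z → d * y ≡ 1# → (d * y) * z ≡ z
  1*-cancel z p = trans (cong (_* z) p) (solve 1 (λ z → :1 :* z := z) refl z)

  *-cancelˡ-≤ : ∀ {d x y} → 0# < d → d * x ≤ d * y → x ≤ y
  *-cancelˡ-≤ {d} {x} {y} 0<d dx≤dy with pos-inverse 0<d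
  ... | e , 0≤e , de≡1 = ≤-from
    (trans (sym (1*-cancel (y - x) de≡1))
      (solve 4 (λ d e x y → (d :* e) :* (y :- x) := e :* (d :* y :- d :* x)) refl d e x y))
    (*-nonneg _ _ 0≤e (0≤y-x dx≤dy))

  +-upperˡ : ∀ {x y} → 0# ≤ y → x ≤ x + y
  +-upperˡ {x} {y} = ≤-from (solve 2 (λ x y → x :+ y :- x := y) refl x y)

  +-upperʳ : ∀ {x y} → 0# ≤ x → y ≤ x + y
  +-upperʳ {x} {y} = ≤-from (solve 2 (λ x y → x :+ y :- y := x) refl x y)

  dominate : ∀ {x} y → 0# < x → ∃[ k ] (0# ≤ k * x + y)
  dominate {x} y 0<x with pos-inverse 0<x
  -- The witness is -y / x, which makes the expression exactly `0#`. It may be negative;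
  -- `uniform-bound` later raises it to a common nonnegative bound.
  ... | z , _ , xz≡1 = - y * z , ≤-reflexive (sym (trans
    (solve 3 (λ x y z → (:- y) :* z :* x :+ y := y :- x :* z :* y) refl x y z)
    (trans (cong (λ a → y - a) (1*-cancel y xz≡1)) (solve 1 (λ y → y :- y := :0) refl y))))

  0<1+x : ∀ {x} → 0# ≤ x → 0# < 1# + x
  0<1+x {x} 0≤x = ≤-trans 0≤1 (+-upperˡ 0≤x) , λ 0≡1+x → 1≰0
    (subst (1# ≤_) (sym 0≡1+x) (+-upperˡ 0≤x))

  contraction-lower : ∀ {a l c} → - a ≤ (1# - l) * c → - c ≤ a + l * (- c)
  contraction-lower {a} {l} {c} p = ≤-from
    (solve 3 (λ a l c → a :+ l :* (:- c) :- (:- c) := (:1 :- l) :* c :- (:- a)) refl a l c)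
    (0≤y-x p)

  -- Replacing `y` by the larger `x` gives (1 - l) x ≤ a ≤ (1 - l) c, and the positive factor 1 - l
  -- cancels.
  contraction-upper : ∀ {a l c x y} → 0# ≤ l × l < 1# → y ≤ x → x ≤ a + l * y →
    a ≤ (1# - l) * c → x ≤ c
  contraction-upper {a} {l} {c} {x} {y} (0≤l , l<1) y≤x x≤a+ly a≤[1-l]c =
    *-cancelˡ-≤ (0<y-x l<1) (≤-trans
      (≤-from
        (solve 4 (λ a l x y → a :- (:1 :- l) :* x := (a :+ l :* y :- x) :+ l :* (x :- y)) refl a l x y)
        (+-nonneg (0≤y-x x≤a+ly) (*-nonneg _ _ 0≤l (0≤y-x y≤x))))
      a≤[1-l]c)

  open Extrema ≤-totalOrder using (max; ⊥≤max; xs≤max)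

  finite-bound : ∀ {n} (g : Fin n → Carrier) → ∃[ c ] (0# ≤ c × (∀ i → g i ≤ c))
  finite-bound {n} g = max 0# gs , ⊥≤max 0# gs ,
    λ i → All.lookup (xs≤max 0# gs) (∈-map⁺ g (∈-allFin i))
    where gs = map g (allFin n)

  -- The witnesses are bounded within each row, then the row bounds are bounded; upward closure of
  -- `P` lets the common bound replace each witness.
  uniform-bound : ∀ {n} (P : Fin n → Fin n → Carrier → Set) →
    (∀ u v {c d} → c ≤ d → P u v c → P u v d) →
    (∀ u v → ∃ (P u v)) → ∃[ c ] (0# ≤ c × (∀ u v → P u v c))
  uniform-bound P up h with finite-bound (λ u → proj₁ (finite-bound (λ v → proj₁ (h u v))))
  ... | c , 0≤c , rows≤c = c , 0≤c , λ u v →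
    up u v (≤-trans (proj₂ (proj₂ (finite-bound (λ v → proj₁ (h u v)))) v) (rows≤c u))
      (proj₂ (h u v))

  -- Knaster–Tarski: the pointwise supremum of all ν with ν ≤ T ν.
  monotone-fixpoint : ∀ {n} (T : (Fin n → Carrier) → (Fin n → Carrier)) →
    (∀ {ν μ} → (∀ v → ν v ≤ μ v) → ∀ u → T ν u ≤ T μ u) →
    ∀ {lo hi : Fin n → Carrier} → (∀ u → lo u ≤ T lo u) →
    (∀ ν → (∀ u → ν u ≤ T ν u) → ∀ u → ν u ≤ hi u) →
    ∃[ s ] (∀ u → s u ≡ T s u)
  monotone-fixpoint {n} T mono {lo} {hi} lo-pre pre≤hi =
    -- By monotonicity `T s` also lies below its own image, so it is one of the valuations of which
    -- `s` is the supremum.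
    s , λ u → antisym (s≤Ts u) (upper (T s) (mono s≤Ts) u)
    where
    Pre : (Fin n → Carrier) → Set
    Pre ν = ∀ u → ν u ≤ T ν u

    Attained : Fin n → Carrier → Set
    Attained u x = ∃[ ν ] (Pre ν × ν u ≡ x)

    supremum : ∀ u → _
    supremum u = sup (Attained u) (lo u , lo , lo-pre , refl)
      (hi u , λ { _ (ν , pre , refl) → pre≤hi ν pre u })

    s : Fin n → Carrier
    s u = proj₁ (supremum u)

    upper : ∀ ν → Pre ν → ∀ u → ν u ≤ s u
    upper ν pre u = proj₁ (proj₂ (supremum u)) (ν u) (ν , pre , refl)

    s≤Ts : Pre s
    s≤Ts u = proj₂ (proj₂ (supremum u)) (T s u)
      λ { _ (ν , pre , refl) → ≤-trans (pre u) (mono (upper ν pre) u) }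

-- Finite sums and the affine dependence of offsets on the valuation.

module GameProperties (R : RealField) where
  open RealField R
  open Game R
  open OrderedField R
  open CommutativeRing commutativeRing using (*-assoc; distribˡ; +-commutativeMonoid)
  open CommutativeSemigroupProperties
    (CommutativeMonoid.commutativeSemigroup +-commutativeMonoid) using (interchange)

  sumFin-cong : ∀ {n} {g h : Fin n → Carrier} → (∀ i → g i ≡ h i) → sumFin g ≡ sumFin h
  sumFin-cong {ℕ.zero}  p = refl
  sumFin-cong {ℕ.suc n} p = cong₂ _+_ (p zero) (sumFin-cong (p ∘ suc))

  sumFin-zero : ∀ {n} {g : Fin n → Carrier} → (∀ i → g i ≡ 0#) → sumFin g ≡ 0#
  sumFin-zero {ℕ.zero}  p = refl
  sumFin-zero {ℕ.suc n} p = trans (cong₂ _+_ (p zero) (sumFin-zero (p ∘ suc)))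
    (solve 0 (:0 :+ :0 := :0) refl)

  sumFin-nonneg : ∀ {n} {g : Fin n → Carrier} → (∀ i → 0# ≤ g i) → 0# ≤ sumFin g
  sumFin-nonneg {ℕ.zero}  p = ≤-refl
  sumFin-nonneg {ℕ.suc n} p = +-nonneg (p zero) (sumFin-nonneg (p ∘ suc))

  mix : Carrier → Carrier → Carrier → Carrier
  mix t x y = (1# - t) * x + t * y

  mix-+ : ∀ t x₁ x₂ y₁ y₂ → mix t x₁ x₂ + mix t y₁ y₂ ≡ mix t (x₁ + y₁) (x₂ + y₂)
  mix-+ t x₁ x₂ y₁ y₂ =
    trans (interchange _ _ _ _) (sym (cong₂ _+_ (distribˡ _ x₁ y₁) (distribˡ t x₂ y₂)))

  mix-neg : ∀ t x y → - mix t x y ≡ mix t (- x) (- y)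
  mix-neg = solve 3 (λ t x y → :- ((:1 :- t) :* x :+ t :* y) := (:1 :- t) :* (:- x) :+ t :* (:- y)) refl

  mix-const : ∀ t x → x ≡ mix t x x
  mix-const = solve 2 (λ t x → x := (:1 :- t) :* x :+ t :* x) refl

  mix-* : ∀ t d x y → d * mix t x y ≡ mix t (d * x) (d * y)
  mix-* = solve 4 (λ t d x y →
    d :* ((:1 :- t) :* x :+ t :* y) := (:1 :- t) :* (d :* x) :+ t :* (d :* y)) refl

  mix-sub : ∀ t x₁ x₂ y₁ y₂ → mix t x₁ x₂ - mix t y₁ y₂ ≡ mix t (x₁ - y₁) (x₂ - y₂)
  mix-sub t x₁ x₂ y₁ y₂ = trans (cong (λ z → mix t x₁ x₂ + z) (mix-neg t y₁ y₂)) (mix-+ t _ _ _ _)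

  sumFin-mix : ∀ {n} t (g h : Fin n → Carrier) →
    sumFin (λ i → mix t (g i) (h i)) ≡ mix t (sumFin g) (sumFin h)
  sumFin-mix {ℕ.zero}  t g h = mix-const t 0#
  sumFin-mix {ℕ.suc n} t g h =
    trans (cong (λ z → mix t (g zero) (h zero) + z) (sumFin-mix t (g ∘ suc) (h ∘ suc)))
      (mix-+ t _ _ _ _)

  module _ {n : ℕ} (G : DPG n) where
    open DPG G

    value : Valuation n → Fin n → Fin n → Carrier
    value ν u v = w u v + disc u v * ν v

    value-mono : ∀ {ν μ} → (∀ v → ν v ≤ μ v) → ∀ {u v} → InE G (u , v) → value ν u v ≤ value μ u v
    value-mono {ν} {μ} ν≤μ {u} {v} e = ≤-from
      (solve 4 (λ a d x y → (a :+ d :* y) :- (a :+ d :* x) := d :* (y :- x)) refl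
        (w u v) (disc u v) (ν v) (μ v))
      (*-nonneg _ _ (proj₁ (disc-range u v e)) (0≤y-x (ν≤μ v)))

    holds⇒0≤offset : ∀ ν u v → Holds G ν (u , v) → 0# ≤ offset G ν (u , v)
    holds⇒0≤offset ν u v h with isMax u
    ... | true  = 0≤y-x h
    ... | false = 0≤y-x h

    0≤offset⇒holds : ∀ ν u v → 0# ≤ offset G ν (u , v) → Holds G ν (u , v)
    0≤offset⇒holds ν u v h with isMax u
    ... | true  = ≤-from refl h
    ... | false = ≤-from refl h

    sharp⇒offset≡0 : ∀ ν u v → Sharp G ν (u , v) → offset G ν (u , v) ≡ 0#
    sharp⇒offset≡0 ν u v p with isMax u
    ... | true  = trans (cong (_- value ν u v) p) (solve 1 (λ x → x :- x := :0) refl _)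
    ... | false = trans (cong (λ z → value ν u v - z) p) (solve 1 (λ x → x :- x := :0) refl _)

    value-mix : ∀ t ν μ u v →
      value (λ x → mix t (ν x) (μ x)) u v ≡ mix t (value ν u v) (value μ u v)
    value-mix t ν μ u v =
      trans (cong₂ _+_ (mix-const t (w u v)) (mix-* t (disc u v) (ν v) (μ v))) (mix-+ t _ _ _ _)

    -- For either owner of `u` the offset is affine in the valuation, with constant term given by
    -- `w u v`; hence `f` is affine along segments.
    offset-mix : ∀ t ν μ u v →
      offset G (λ x → mix t (ν x) (μ x)) (u , v) ≡ mix t (offset G ν (u , v)) (offset G μ (u , v))
    offset-mix t ν μ u v with isMax u
    ... | true  = trans (cong (λ z → mix t (ν u) (μ u) - z) (value-mix t ν μ u v)) (mix-sub t _ _ _ _)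
    ... | false = trans (cong (_- mix t (ν u) (μ u)) (value-mix t ν μ u v)) (mix-sub t _ _ _ _)

    f-mix : ∀ σ t ν μ → f G σ (λ x → mix t (ν x) (μ x)) ≡ mix t (f G σ ν) (f G σ μ)
    f-mix σ t ν μ = trans (sumFin-cong λ v → offset-mix t ν μ v (σ v))
      (sumFin-mix t (λ v → offset G ν (v , σ v)) (λ v → offset G μ (v , σ v)))

    -- Valuations of one basis are known to agree only pointwise; this carries such agreement over
    -- to `f`.
    offset-cong : ∀ {ν μ} → (∀ v → ν v ≡ μ v) → ∀ u v → offset G ν (u , v) ≡ offset G μ (u , v)
    offset-cong p u v with isMax u
    ... | true  = cong₂ (λ x y → x - (w u v + disc u v * y)) (p u) (p v)
    ... | false = cong₂ (λ x y → w u v + disc u v * y - x) (p u) (p v)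

    f-cong : ∀ σ {ν μ} → (∀ v → ν v ≡ μ v) → f G σ ν ≡ f G σ μ
    f-cong σ p = sumFin-cong λ v → offset-cong p v (σ v)

    -- Values of games with restricted moves.

    0<1-disc : ∀ {u v} → InE G (u , v) → 0# < 1# - disc u v
    0<1-disc e = 0<y-x (proj₂ (disc-range _ _ e))

    -- On a single edge the quotient of `h u v` by the positive `1# - disc u v` serves as the
    -- constant; non-edges take `0#`. Enlarging `c` keeps each inequality, so one constant serves
    -- all edges.
    discounted-bound : (h : Fin n → Fin n → Carrier) →
      ∃[ c ] (0# ≤ c × (∀ u v → InE G (u , v) → h u v ≤ (1# - disc u v) * c))
    discounted-bound h = uniform-bound _
      (λ u v c≤d p e → ≤-trans (p e) (*-monoʳ-≤ (proj₁ (0<1-disc e)) c≤d))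
      witness
      where
      witness : ∀ u v → ∃[ c ] (InE G (u , v) → h u v ≤ (1# - disc u v) * c)
      witness u v with T? (edge u v)
      ... | no ¬e = 0# , λ e → ⊥-elim (¬e e)
      ... | yes e with pos-inverse (0<1-disc e)
      ...   | y , _ , dy≡1 = y * h u v , λ _ → ≤-reflexive (trans (sym (1*-cancel (h u v) dy≡1))
        (*-assoc (1# - disc u v) y (h u v)))

    -- The order seen by the owner of a vertex. Reversing it for the minimising player lets one
    -- `argmax` choose moves for both.
    Prefers : Bool → Carrier → Carrier → Set
    Prefers true  x y = x ≤ y
    Prefers false x y = y ≤ x

    prefers⇒holds : ∀ ν u v → Prefers (isMax u) (value ν u v) (ν u) → Holds G ν (u , v)
    prefers⇒holds ν u v p with isMax u
    ... | true  = p
    ... | false = p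

    prefers-isTotalOrder : ∀ p → IsTotalOrder _≡_ (Prefers p)
    prefers-isTotalOrder true  = isTotalOrder
    prefers-isTotalOrder false = Flip.isTotalOrder isTotalOrder

    preference : Fin n → TotalOrder 0ℓ 0ℓ 0ℓ
    preference u = record { isTotalOrder = prefers-isTotalOrder (isMax u) }

    -- The value of the game in which the moves from u are restricted to ψ u ∷ opts u.
    module Restricted (ψ : Fin n → Fin n) (opts : Fin n → List (Fin n))
      (moves-InE : ∀ u v → v ∈ ψ u ∷ opts u → InE G (u , v)) where

      -- `ψ u` is the default of `argmax`, so a move exists even when `opts u` is empty.
      best : Valuation n → Fin n → Fin n
      best ν u = Extrema.argmax (preference u) (value ν u) (ψ u) (opts u)

      best-∈ : ∀ ν u → best ν u ∈ ψ u ∷ opts u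
      best-∈ ν u with Extrema.argmax-sel (preference u) (value ν u) (ψ u) (opts u)
      ... | inj₁ p = here p
      ... | inj₂ p = there p

      bellman : Valuation n → Valuation n
      bellman ν u = value ν u (best ν u)

      best-optimal : ∀ ν u v → v ∈ ψ u ∷ opts u →
        Prefers (isMax u) (value ν u v) (bellman ν u)
      best-optimal ν u v (here refl) =
        Extrema.f[⊥]≤f[argmax] (preference u) {f = value ν u} (ψ u) (opts u)
      best-optimal ν u v (there v∈) =
        All.lookup (Extrema.f[xs]≤f[argmax] (preference u) {f = value ν u} (ψ u) (opts u)) v∈

      -- A maximising vertex evaluates the move that is best for `ν` under both valuations; a
      -- minimising vertex does so with the move that is best for `μ`.
      bellman-mono : ∀ {ν μ} → (∀ v → ν v ≤ μ v) → ∀ u → bellman ν u ≤ bellman μ u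
      bellman-mono {ν} {μ} ν≤μ u = compare
        (best-optimal μ u (best ν u) (best-∈ ν u)) (best-optimal ν u (best μ u) (best-∈ μ u))
        (value-mono ν≤μ (moves-InE u _ (best-∈ ν u))) (value-mono ν≤μ (moves-InE u _ (best-∈ μ u)))
        where
        compare : ∀ {x x′ y y′} →
          Prefers (isMax u) y x′ → Prefers (isMax u) y′ x →
          x ≤ y → y′ ≤ x′ → x ≤ x′
        compare p q with isMax u
        ... | true  = λ r _ → ≤-trans r p
        ... | false = λ _ r → ≤-trans q r

      weight-bound : ∃[ c ] (∀ u v → InE G (u , v) →
        (w u v ≤ (1# - disc u v) * c) × (- w u v ≤ (1# - disc u v) * c))
      weight-bound = combine-bounds (discounted-bound w) (discounted-bound λ u v → - w u v)
        where
        combine-bounds : ∀ {g h : Fin n → Fin n → Carrier} →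
          ∃[ c ] (0# ≤ c × (∀ u v → InE G (u , v) → g u v ≤ (1# - disc u v) * c)) →
          ∃[ c ] (0# ≤ c × (∀ u v → InE G (u , v) → h u v ≤ (1# - disc u v) * c)) →
          ∃[ c ] (∀ u v → InE G (u , v) →
            (g u v ≤ (1# - disc u v) * c) × (h u v ≤ (1# - disc u v) * c))
        -- Both constants are nonnegative, so their sum dominates each.
        combine-bounds (c , 0≤c , p) (d , 0≤d , q) = c + d , λ u v e →
          ≤-trans (p u v e) (*-monoʳ-≤ (proj₁ (0<1-disc e)) (+-upperˡ 0≤d)) ,
          ≤-trans (q u v e) (*-monoʳ-≤ (proj₁ (0<1-disc e)) (+-upperʳ 0≤c))

      module _ (c : Carrier) (c-bound : ∀ u v → InE G (u , v) →
        (w u v ≤ (1# - disc u v) * c) × (- w u v ≤ (1# - disc u v) * c)) where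

        constant-below : ∀ u v → InE G (u , v) → - c ≤ value (λ _ → - c) u v
        constant-below u v e = contraction-lower (proj₂ (c-bound u v e))

        -- At a vertex `û` of largest value the successor is worth at most `ν û`, so the discount
        -- forces `ν û` below `c`.
        pre-bounded : ∀ ν → (∀ u → ν u ≤ bellman ν u) → ∀ u → ν u ≤ c
        pre-bounded ν pre u = ≤-trans (maximal u)
          (contraction-upper (disc-range û (best ν û) e) (maximal (best ν û)) (pre û)
            (proj₁ (c-bound û (best ν û) e)))
          where
          û = Extrema.argmax ≤-totalOrder ν u (allFin n)

          maximal : ∀ x → ν x ≤ ν û
          maximal x = All.lookup (Extrema.f[xs]≤f[argmax] ≤-totalOrder {f = ν} u (allFin n)) (∈-allFin x)

          e = moves-InE û (best ν û) (best-∈ ν û)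

        bellman-fixpoint : ∃[ s ] (∀ u → s u ≡ bellman s u)
        bellman-fixpoint = monotone-fixpoint bellman bellman-mono {λ _ → - c} {λ _ → c}
          (λ u → constant-below u (best (λ _ → - c) u) (moves-InE u _ (best-∈ _ u)))
          pre-bounded

      abstract
        game-value : ∃[ s ] (∀ u → s u ≡ bellman s u)
        game-value = bellman-fixpoint (proj₁ weight-bound) (proj₂ weight-bound)

      s : Valuation n
      s = proj₁ game-value

      -- By definition of `bellman`, the fixpoint equation is sharpness of the chosen edge.
      s-sharp : ∀ u → Sharp G s (u , best s u)
      s-sharp = proj₂ game-value

      s-holds : ∀ u v → v ∈ ψ u ∷ opts u → Holds G s (u , v)
      s-holds u v v∈ = prefers⇒holds s u v
        (subst (Prefers (isMax u) (value s u v)) (sym (s-sharp u)) (best-optimal s u v v∈))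

    -- A basis determines its valuation up to pointwise equality, so the codes
    -- cannot repeat along a strictly f_σ-decreasing sequence of bases.
    code : Family G → Fin ((n ℕ.* n) ℕ.^ n)
    code b = funToFin (uncurry combine ∘ b)

    code-injective : ∀ b c → code b ≡ code c → ∀ i → b i ≡ c i
    code-injective b c p i = uncurry (cong₂ _,_) (combine-injective _ _ _ _
      (trans (sym (finToFun-funToFin (uncurry combine ∘ b) i))
        (trans (cong (λ k → finToFun k i) p) (finToFun-funToFin (uncurry combine ∘ c) i))))

    valuation-unique : ∀ b c {ν μ} → code b ≡ code c → IsValOf G b ν → IsValOf G c μ → ∀ v → ν v ≡ μ v
    valuation-unique b c {ν} {μ} p ((_ , _ , _ , unique) , solves) (_ , solves′) =
      unique ν μ solves (λ i → subst (Sharp G μ) (sym (code-injective b c p i)) (solves′ i))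

    -- Descent along bases to a minimum of `f`.

    module _ (σ : Fin n → Fin n) where

      -- The relation lives on codes because a strict partial order on a finite type is
      -- well-founded.
      Descends : Fin ((n ℕ.* n) ℕ.^ n) → Fin ((n ℕ.* n) ℕ.^ n) → Set
      Descends i j = Σ (Family G) λ b → Σ (Family G) λ c → ∃[ ν ] ∃[ μ ]
        (code b ≡ i × code c ≡ j × IsValOf G b ν × IsValOf G c μ × f G σ ν < f G σ μ)

      descends-wellFounded : WellFounded Descends
      descends-wellFounded = spo-wellFounded record
        { isEquivalence = isEquivalence
        ; irrefl = λ { refl (b , c , ν , μ , p , q , vb , vc , _ , ν≢μ) →
            ν≢μ (f-cong σ (valuation-unique b c (trans p (sym q)) vb vc)) }
        ; trans = λ { (b , c , ν , μ , p , q , vb , vc , lt) (b′ , c′ , ν′ , μ′ , p′ , q′ , vb′ , vc′ , lt′) →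
            b , c′ , ν , μ′ , p , q′ , vb , vc′ ,
            -- `c` and `b′` share a code, so `μ` and `ν′` have the same `f`-value and the two
            -- inequalities chain.
            <-trans (subst (f G σ ν <_)
              (f-cong σ (valuation-unique c b′ (trans q (sym p′)) vc vb′)) lt) lt′ }
        ; <-resp-≈ = (λ { refl d → d }) , (λ { refl d → d })
        }

      -- Minimality is a universal statement over decidable, hence stable, inequalities. This makes
      -- weak excluded middle enough to decide it.
      minimises-stable : ∀ {ν} → ¬ ¬ Minimises G σ ν → Minimises G σ ν
      minimises-stable ¬¬min μ sat = decidable-stable (_ ≤? _) λ k → ¬¬min λ min → k (min μ sat)

      -- Well-founded induction on the code of the basis: as long as the valuation is not minimal,
      -- an improving neighbour is feasible again and has a smaller `f`-value.
      minimiser : IsImproving G → JointStrategy G σ → ∀ b ν → IsValOf G b ν → SatH G ν →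
        ∃[ μ ] (SatH G μ × Minimises G σ μ × f G σ μ ≤ f G σ ν)
      minimiser (_ , improve) joint b ν = go b ν (descends-wellFounded (code b))
        where
        go : ∀ b ν → Acc Descends (code b) → IsValOf G b ν → SatH G ν →
          ∃[ μ ] (SatH G μ × Minimises G σ μ × f G σ μ ≤ f G σ ν)
        go b ν (acc rec) val sat with weak-excluded-middle (Minimises G σ ν)
        ... | inj₂ ¬¬min = ν , sat , minimises-stable ¬¬min , ≤-refl
        ... | inj₁ ¬min with improve σ joint b ν val sat ¬min
        ...   | b′ , ν′ , _ , val′ , sat′ , lt
          with go b′ ν′ (rec (b′ , b , ν′ , ν , refl , refl , val′ , val , lt)) val′ sat′
        ...     | μ , satμ , minμ , le = μ , satμ , minμ , ≤-trans le (proj₁ lt)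

    -- Moving from ν by a small step t towards a valuation s of f_σ-value 0 scales
    -- f_σ by 1 - t and preserves every inequation that is not sharp for ν.
    not-minimal : ∀ σ ν s → JointStrategy G σ → SatH G ν → f G σ ν ≢ 0# → f G σ s ≡ 0# →
      (∀ u v → InE G (u , v) → offset G ν (u , v) ≡ 0# → 0# ≤ offset G s (u , v)) →
      ¬ Minimises G σ ν
    not-minimal σ ν s joint sat fν≢0 fs≡0 s-ok min =
      fν≢0 (antisym (conclude (uniform-bound Slack slack-up slack)) 0≤fν)
      where
      0≤offset : ∀ u v → InE G (u , v) → 0# ≤ offset G ν (u , v)
      0≤offset u v e = holds⇒0≤offset ν u v (sat (u , v) e)

      0≤fν : 0# ≤ f G σ ν
      0≤fν = sumFin-nonneg λ v → 0≤offset v (σ v) (joint v)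

      -- For the step t = 1 / (1 + k), the offset at the mixed valuation is t times this expression,
      -- so such a `k` keeps the edge satisfied after the step.
      Slack : Fin n → Fin n → Carrier → Set
      Slack u v k = InE G (u , v) → offset G ν (u , v) ≢ 0# →
        0# ≤ k * offset G ν (u , v) + offset G s (u , v)

      slack-up : ∀ u v {c d} → c ≤ d → Slack u v c → Slack u v d
      slack-up u v c≤d p e a≢0 = ≤-trans (p e a≢0)
        (+-mono-≤ _ _ _ (*-monoˡ-≤ (0≤offset u v e) c≤d))

      slack : ∀ u v → ∃ (Slack u v)
      slack u v with T? (edge u v) | offset G ν (u , v) ≟ 0#
      ... | no ¬e | _       = 0# , λ e _ → ⊥-elim (¬e e)
      ... | yes _ | yes a≡0 = 0# , λ _ a≢0 → ⊥-elim (a≢0 a≡0)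
      ... | yes e | no a≢0  = proj₁ k , λ _ _ → proj₂ k
        where k = dominate (offset G s (u , v)) (0≤offset u v e , a≢0 ∘ sym)

      module _ (K : Carrier) (0≤K : 0# ≤ K) (slackK : ∀ u v → Slack u v K)
        (t : Carrier) (0≤t : 0# ≤ t) (Kt≡1 : (1# + K) * t ≡ 1#) where

        -- The choice of `t` gives 1 - t = K t, so `t` factors out.
        mix-scaled : ∀ x y → mix t x y ≡ t * (K * x + y)
        mix-scaled x y = trans (cong (λ z → (z - t) * x + t * y) (sym Kt≡1))
          (solve 4 (λ t k x y → ((:1 :+ k) :* t :- t) :* x :+ t :* y := t :* (k :* x :+ y)) refl t K x y)

        ν′ : Valuation n
        ν′ x = mix t (ν x) (s x)

        sat′ : SatH G ν′
        sat′ (u , v) e = 0≤offset⇒holds ν′ u v (subst (0# ≤_)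
          (sym (trans (offset-mix t ν s u v) (mix-scaled _ _)))
          (*-nonneg _ _ 0≤t slacked))
          where
          slacked : 0# ≤ K * offset G ν (u , v) + offset G s (u , v)
          slacked with offset G ν (u , v) ≟ 0#
          ... | no a≢0  = slackK u v e a≢0
          ... | yes a≡0 = +-nonneg (*-nonneg _ _ 0≤K (0≤offset u v e)) (s-ok u v e a≡0)

        fν′ : f G σ ν′ ≡ (1# - t) * f G σ ν
        fν′ = trans (f-mix σ t ν s) (trans (cong (mix t (f G σ ν)) fs≡0)
          (solve 2 (λ t x → (:1 :- t) :* x :+ t :* :0 := (:1 :- t) :* x) refl t (f G σ ν)))

        -- Minimality of `ν` against `ν′` makes (1 - t) f - f = - t f nonnegative; multiplying by 1
        -- + K removes the factor `t`.
        scaled-minimum : f G σ ν ≤ 0#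
        scaled-minimum = ≤-from
          (trans (cong (λ z → 0# - z) (sym (1*-cancel (f G σ ν) Kt≡1)))
            (solve 3 (λ k t x → :0 :- (:1 :+ k) :* t :* x := (:1 :+ k) :* ((:1 :- t) :* x :- x)) refl
              K t (f G σ ν)))
          (*-nonneg _ _ (+-nonneg 0≤1 0≤K) (subst (λ z → 0# ≤ z - f G σ ν) fν′ (0≤y-x (min ν′ sat′))))

      conclude : ∃[ k ] (0# ≤ k × (∀ u v → Slack u v k)) → f G σ ν ≤ 0#
      conclude (k , 0≤k , slacks) = with-step (pos-inverse (0<1+x 0≤k))
        where
        with-step : ∃[ t ] (0# ≤ t × (1# + k) * t ≡ 1#) → f G σ ν ≤ 0#
        with-step (t , 0≤t , kt≡1) = scaled-minimum k 0≤k slacks t 0≤t kt≡1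

    Eν? : ∀ ν u v → Dec (Eν G ν (u , v))
    Eν? ν u v = T? (edge u v) ×-dec (offset G ν (u , v) ≟ 0#)

-- The strategy taken from the restricted game and its comparison with `σ`.

theorem4p4 : (R : RealField) → let open RealField R in let open Game R in
    ∀ {n : ℕ} (G : DPG n) → IsImproving G →
    (σ : Fin n → Fin n) → JointStrategy G σ →
    (b : Family G) (ν : Valuation n) → IsValOf G b ν → SatH G ν →
    Minimises G σ ν → f G σ ν ≢ 0# →
    (∀ u v → InE G (u , v) → offset G ν (u , σ u) ≤ offset G ν (u , v)) →
    (E' : Edge n → Set) →
    (∀ e → Eν G ν e → E' e) → (∀ e → E' e → S G σ ν e) →
    (∀ u → ∃[ v ] E' (u , v)) →
    Σ (Family G) λ b'' → Σ (Valuation n) λ ν'' → Σ (Fin n → Fin n) λ σ' →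
    Neighbour G b b'' × IsValOf G b'' ν'' × JointStrategy G σ' ×
    (f G σ' ν'' < f G σ ν) × Better G σ' σ × (∀ v → E' (v , σ' v))
theorem4p4 R {n} G improving@(_ , improve) σ joint b ν val sat min fν≢0 _ E' Eν⊆E' E'⊆S E'-total =
  conclude (improve σ' joint' b ν val sat ¬min)
  where
  open RealField R
  open Game R
  open OrderedField R
  open GameProperties R

  ψ : Fin n → Fin n
  ψ u = proj₁ (E'-total u)

  -- Every edge sharp for `ν` is offered, so that `s` satisfies it and the segment towards `s` does
  -- not violate it at once; `ψ` supplies a move where no edge is sharp.
  opts : Fin n → List (Fin n)
  opts u = filter (Eν? G ν u) (allFin n)

  moves-E' : ∀ u v → v ∈ ψ u ∷ opts u → E' (u , v)
  moves-E' u v (here refl) = proj₂ (E'-total u)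
  moves-E' u v (there v∈)  = Eν⊆E' (u , v) (proj₂ (∈-filter⁻ (Eν? G ν u) {xs = allFin n} v∈))

  open Restricted G ψ opts (λ u v v∈ → proj₁ (E'⊆S (u , v) (moves-E' u v v∈)))

  σ' : Fin n → Fin n
  σ' = best s

  σ'-E' : ∀ u → E' (u , σ' u)
  σ'-E' u = moves-E' u (σ' u) (best-∈ s u)

  joint' : JointStrategy G σ'
  joint' u = proj₁ (E'⊆S _ (σ'-E' u))

  -- Edges in `S` have the same offset at `ν` as the edge chosen by `σ`.
  fσ'≡fσ : f G σ' ν ≡ f G σ ν
  fσ'≡fσ = sumFin-cong λ u → proj₂ (E'⊆S _ (σ'-E' u))

  ¬min : ¬ Minimises G σ' ν
  ¬min = not-minimal G σ' ν s joint' sat (fν≢0 ∘ trans (sym fσ'≡fσ))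
    (sumFin-zero λ u → sharp⇒offset≡0 G s u (σ' u) (s-sharp u))
    λ u v e a≡0 → holds⇒0≤offset G s u v
      (s-holds u v (there (∈-filter⁺ (Eν? G ν u) (∈-allFin v) (e , a≡0))))

  -- The minimum for `σ` is attained at `ν` itself; the one for `σ'` is attained at `μ` and is at
  -- most the value at `ν''`.
  better : ∀ {ν''} → f G σ' ν'' < f G σ ν →
    ∃[ μ ] (SatH G μ × Minimises G σ' μ × f G σ' μ ≤ f G σ' ν'') → Better G σ' σ
  better lt (μ , satμ , minμ , le) = f G σ' μ , f G σ ν ,
    ((μ , satμ , refl) , minμ) , ((ν , sat , refl) , min) , ≤-<-trans le lt

  conclude : (Σ (Family G) λ b'' → Σ (Valuation n) λ ν'' →
      Neighbour G b b'' × IsValOf G b'' ν'' × SatH G ν'' × (f G σ' ν'' < f G σ' ν)) →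
    Σ (Family G) λ b'' → Σ (Valuation n) λ ν'' → Σ (Fin n → Fin n) λ σ' →
      Neighbour G b b'' × IsValOf G b'' ν'' × JointStrategy G σ' ×
      (f G σ' ν'' < f G σ ν) × Better G σ' σ × (∀ v → E' (v , σ' v))
  conclude (b'' , ν'' , nb , val'' , sat'' , lt) =
    b'' , ν'' , σ' , nb , val'' , joint' , lt' ,
    better lt' (minimiser G σ' improving joint' b'' ν'' val'' sat'') , σ'-E'
    where lt' = subst (f G σ' ν'' <_) fσ'≡fσ lt
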